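{- Let $n\ge 3$ be an integer and let $K=\{213,132,231\}$. The number of equivalence classes of $S_n$ under $K$-equivalence is $2^{n-2}+2n-4$.
   Context: Permutations in $S_n$ are written as words $\pi_1\pi_2\cdots\pi_n$ in one-line notation. The order permutation of a word $u$ of $c$ distinct positive integers is the unique $\sigma\in S_c$ with $\sigma_i<\sigma_j$ iff $u_i<u_j$. A replacement partition $K$ of $S_c$ is a set partition of $S_c$; it is denoted by listing its parts with the one-element parts (and outer brackets) omitted, so here $K$ is the set partition of $S_3$ whose only part of size greater than one is $\{213,132,231\}$. The $K$-equivalence on $S_n$ is the equivalence relation generated by: $\phi\equiv\psi$ whenever $\phi=aub$ and $\psi=avb$ (concatenations) for some possibly empty words $a,b$ and words $u,v$ of length $c$ (so $u,v$ occupy the same $c$ consecutive positions) such that the order permutations of $u$ and $v$ lie in the same part of $K$. All equivalence classes are counted, including one-element classes. -}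

module Defs where

open import Data.Fin using (Fin)
open import Data.List using (List; []; _∷_; _++_; applyUpTo)
open import Data.List.Membership.Propositional using (_∈_)
open import Data.List.Relation.Binary.Permutation.Propositional using (_↭_)
open import Data.List.Relation.Unary.Any using (Any)
open import Data.Nat using (ℕ; suc; _<_)
open import Data.Product using (∃; _×_; proj₁)
open import Data.Sum using (_⊎_)
open import Data.Vec as Vec using (Vec; []; _∷_; lookup)
open import Function.Bundles using (_⇔_; Bijection)
open import Level using (0ℓ)
open import Relation.Binary using (Rel; Setoid)
open import Relation.Binary.Construct.Closure.Equivalence as EqClosure
  using (EqClosure)
import Relation.Binary.Construct.On as On
open import Relation.Binary.PropositionalEquality as ≡ using (_≡_)

Word : Set
Word = List ℕ

-- w is the one-line notation of an element of S_n: a rearrangement of 1 2 ⋯ n.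
IsPermutation : ℕ → Word → Set
IsPermutation n w = w ↭ applyUpTo suc n

S : ℕ → Set
S n = ∃ (IsPermutation n)

IsOrderPermutation : ∀ {c} → Vec ℕ c → Vec ℕ c → Set
IsOrderPermutation {c} u σ =
  IsPermutation c (Vec.toList σ) ×
  (∀ i j → (lookup σ i < lookup σ j) ⇔ (lookup u i < lookup u j))

-- A set partition of S_c, given by its parts of size greater than one (assumed
-- to be disjoint sets of permutations); every other permutation is a part by
-- itself.
ReplacementPartition : ℕ → Set
ReplacementPartition c = List (List (Vec ℕ c))

SamePart : ∀ {c} → ReplacementPartition c → Rel (Vec ℕ c) 0ℓ
SamePart K σ τ = σ ≡ τ ⊎ Any (λ part → σ ∈ part × τ ∈ part) K

-- Both words are required to lie in S_n, so u and v have the same letters and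
-- chains of replacements never leave S_n.
record Replacement {c} (K : ReplacementPartition c) (n : ℕ) (φ ψ : Word) : Set where
  field
    φ∈Sₙ     : IsPermutation n φ
    ψ∈Sₙ     : IsPermutation n ψ
    a b      : Word
    u v      : Vec ℕ c
    φ≡aub    : φ ≡ a ++ Vec.toList u ++ b
    ψ≡avb    : ψ ≡ a ++ Vec.toList v ++ b
    σ τ      : Vec ℕ c
    order-u  : IsOrderPermutation u σ
    order-v  : IsOrderPermutation v τ
    samePart : SamePart K σ τ

-- S n with K-equivalence. The relation depends only on the words, not on the
-- proofs that they are permutations.
K-equivalence : ∀ {c} → ReplacementPartition c → ℕ → Setoid 0ℓ 0ℓ
K-equivalence K n =
  On.setoid {B = S n} (EqClosure.setoid (Replacement K n)) proj₁

-- The quotient of A by its equivalence has exactly k elements.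
HasClassCount : Setoid 0ℓ 0ℓ → ℕ → Set
HasClassCount A k = Bijection A (≡.setoid (Fin k))

K : ReplacementPartition 3
K = ( (2 ∷ 1 ∷ 3 ∷ [])
    ∷ (1 ∷ 3 ∷ 2 ∷ [])
    ∷ (2 ∷ 3 ∷ 1 ∷ [])
    ∷ []) ∷ []

{-# OPTIONS --safe #-}
module Submission where

-- Three consecutive letters are called red when their relative order is 213,
-- 132 or 231.  On words with distinct letters the equivalence is generated by
-- rearranging a red factor into another red arrangement of the same letters,
-- and a word is active when it has a red factor.  (A replacement between
-- factors with the same order permutation changes nothing: if two words use
-- the same letters in the same relative order, counting for each position the
-- letters below it shows that they are equal.)
--
-- Consider words on letters m > s > t > ..., where m is the greatest and s the
-- second greatest letter.
--
-- * A leading m belongs to no red factor, so it never moves, and the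
--   classification of words m v is that of the shorter words v.
--
-- * An inactive word is alone in its class.  In an inactive word the greatest
--   letter is at one of the two ends, since in the interior it would be a
--   peak.  Hence, for n > 2 letters, the inactive words that do not start with m
--   are the words v m for which v is built from 12 by adding the letters
--   3, 4, ..., n - 1 successively, each at either end; there are 2 ^ (n - 3) of
--   them.
--
-- * Active words not starting with m are called mobile.  Such a word is of the
--   first kind if it starts with s, or with i m s for some letter i, and of the
--   second kind otherwise.  The kind is invariant (SecondLeads-resp-Step): if
--   the first three letters are red, the first kind means that both m and s are
--   among them.  Conversely the mobile words of one kind are all equivalent, by
--   induction on the length (connected).  On at least four letters, a mobile
--   word of the first kind is equivalent to s v and one of the second kind to
--   i v with i < s, where v is again mobile (peel-second, peel-lower); by
--   induction only the kind of v matters.  The two kinds of v, and the different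
--   letters i, are linked by the moves
--
--     s x m y t ~ s m x y t ~ s m x t y ~ s x m t y    (t > x > y),
--     i s t m ~ t s i m                                (i < t),
--     i y s m ~ i s y m                                (y < i),
--     i t x m s ~ x t i m s                            (i < x < t).
--
--   For n = 3 only the first kind occurs; for n > 3 both do.
--
-- Passing from n - 1 to n letters therefore adds 2 ^ (n - 3) + 2 classes when
-- n > 3, and there are 4 classes for n = 3.  The count is turned into a
-- bijection by a normal form: it is constant on classes, each word is
-- equivalent to its normal form, and the normal forms are the entries of a list
-- without repetition.

open import Data.Empty using (⊥-elim)
open import Data.Fin using (Fin; zero; suc)
open import Data.List
  using (List; []; _∷_; _++_; _∷ʳ_; [_]; applyDownFrom; applyUpTo; length; lookup; map)
open import Data.List.Membership.Propositional using (_∈_)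
open import Data.List.Membership.Propositional.Properties
  using (∈-lookup; ∈-map⁺; ∈-map⁻; ∈-++⁺ˡ; ∈-++⁺ʳ; ∈-++⁻)
open import Data.List.Properties
  using (∷-injectiveʳ; ∷ʳ-injectiveˡ; length-++; length-map; reverse-applyUpTo)
open import Data.List.Relation.Binary.Disjoint.Propositional using (Disjoint)
open import Data.List.Relation.Binary.Permutation.Propositional
open import Data.List.Relation.Binary.Permutation.Propositional.Properties
  using (All-resp-↭; drop-∷; map⁺; shift; ↭-length; ↭-reverse; ↭-singleton-inv; ∈-resp-↭;
         ∷↭∷ʳ; ++-comm; ++⁺ʳ)
import Data.List.Relation.Binary.Permutation.Setoid.Properties as ↭ₛ
open import Data.List.Relation.Unary.All as All using (All; []; _∷_)
open import Data.List.Relation.Unary.AllPairs as AllPairs using (AllPairs; []; _∷_)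
import Data.List.Relation.Unary.AllPairs.Properties as AllPairs
open import Data.List.Relation.Unary.Any using (here; index; there)
import Data.List.Relation.Unary.Any.Properties as Any
open import Data.List.Relation.Unary.Unique.Propositional using (Unique)
import Data.List.Relation.Unary.Unique.Propositional.Properties as Unique
open import Data.Nat
  using (ℕ; zero; suc; _≟_; _≥_; _+_; _*_; _∸_; _^_; _<_; _>_; _≤_; s<s; s≤s; z<s; z≤n)
open import Data.Nat.ListAction using (sum)
open import Data.Nat.ListAction.Properties using (sum-↭)
open import Data.Nat.Properties
  using (+-identityʳ; +-mono-<-≤; +-mono-≤; +-mono-≤-<; m+n∸n≡m; m≤n⇒m≤1+n; n<1+n;
         suc-injective; _<?_; <-asym; <-cmp; <-irrefl; <-trans; <-≤-trans; <⇒≢; <⇒≤; >⇒≢;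
         ≤-refl; ≤∧≢⇒<)
open import Data.Nat.Tactic.RingSolver using (solve-∀)
open import Data.Product using (∃; ∃₂; _×_; _,_; proj₁)
open import Data.Sum as Sum using (_⊎_; inj₁; inj₂)
open import Data.Vec as Vec using (Vec; []; _∷_)
import Data.Vec.Properties as Vec
open import Function using (_∘_)
open import Function.Bundles using (Equivalence; mk⇔; _⇔_)
open import Relation.Binary using (tri<; tri≈; tri>)
open import Relation.Binary.Construct.Closure.Equivalence as EqClosure using (EqClosure)
open import Relation.Binary.Construct.Closure.ReflexiveTransitive using (ε; _◅_)
open import Relation.Binary.Construct.Closure.Symmetric using (bwd; fwd)
open import Relation.Binary.PropositionalEquality as ≡
  using (_≡_; _≢_; cong; cong₂; refl; setoid; subst; sym)
open import Relation.Nullary using (Dec; no; yes; ¬_)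
open import Relation.Nullary.Decidable using (map′; _×-dec_; _⊎-dec_)
open import Defs

-- Red factors and the moves between them

variable
  a b c i k m n s t x y z x′ y′ z′ : ℕ
  r u v w w′ ls : Word

-- Red x y z: the letters x y z are in relative order 213, 132 or 231.  The
-- constructors name the pattern with a < b < c.
data Red : ℕ → ℕ → ℕ → Set where
  bac : a < b → b < c → Red b a c
  acb : a < b → b < c → Red a c b
  bca : a < b → b < c → Red b c a

-- The word has a red factor.
data Active : Word → Set where
  here  : Red x y z → Active (x ∷ y ∷ z ∷ w)
  there : Active w → Active (x ∷ w)

-- One replacement inside a red factor, without reference to the whole alphabet.
data Step : Word → Word → Set where
  here  : Red x y z → Red x′ y′ z′ → x ∷ y ∷ z ∷ [] ↭ x′ ∷ y′ ∷ z′ ∷ [] →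
          Step (x ∷ y ∷ z ∷ w) (x′ ∷ y′ ∷ z′ ∷ w)
  there : Step w w′ → Step (x ∷ w) (x ∷ w′)

infix 4 _≈_
_≈_ : Word → Word → Set
_≈_ = EqClosure Step

≈-trans : u ≈ v → v ≈ w → u ≈ w
≈-trans = EqClosure.transitive Step

≈-sym : u ≈ v → v ≈ u
≈-sym = EqClosure.symmetric Step

∷-cong : ∀ x → v ≈ w → x ∷ v ≈ x ∷ w
∷-cong x = EqClosure.gmap (x ∷_) there

module ≈-Reasoning where
  open import Relation.Binary.Reasoning.Setoid (EqClosure.setoid Step) public

bac≈acb : a < b → b < c → b ∷ a ∷ c ∷ w ≈ a ∷ c ∷ b ∷ w
bac≈acb p q = EqClosure.return
  (here (bac p q) (acb p q) (trans (swap _ _ refl) (prep _ (swap _ _ refl))))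

bac≈bca : a < b → b < c → b ∷ a ∷ c ∷ w ≈ b ∷ c ∷ a ∷ w
bac≈bca p q = EqClosure.return
  (here (bac p q) (bca p q) (prep _ (swap _ _ refl)))

acb≈bca : a < b → b < c → a ∷ c ∷ b ∷ w ≈ b ∷ c ∷ a ∷ w
acb≈bca p q = ≈-trans (≈-sym (bac≈acb p q)) (bac≈bca p q)

Step⇒↭ : Step v w → v ↭ w
Step⇒↭ (here _ _ p) = ++⁺ʳ _ p
Step⇒↭ (there p)    = prep _ (Step⇒↭ p)

≈⇒↭ : v ≈ w → v ↭ w
≈⇒↭ = EqClosure.fold ↭-isEquivalence Step⇒↭

-- Three distinct letters with the greatest one in the middle are always red.
peak : x < y → z < y → x ≢ z → Red x y z
peak {x} {_} {z} x<y z<y x≢z with <-cmp x z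
... | tri< x<z _ _ = acb x<z z<y
... | tri≈ _ x≡z _ = ⊥-elim (x≢z x≡z)
... | tri> _ _ z<x = bca z<x x<y

-- Alphabets and the two greatest letters

-- An alphabet is listed as a decreasing word; m and s are its first two letters.
Decreasing : Word → Set
Decreasing = AllPairs _>_

Unique-resp-↭ : v ↭ w → Unique v → Unique w
Unique-resp-↭ p = ↭ₛ.Unique-resp-↭ (setoid ℕ) (↭⇒↭ₛ p)

decreasing⇒unique : Decreasing ls → Unique ls
decreasing⇒unique = AllPairs.map >⇒≢

extract : x ∈ ls → ∃ λ r → x ∷ r ↭ ls
extract (here refl) = _ , refl
extract {x} {y ∷ ls} (there p) with r , q ← extract p =
  y ∷ r , trans (swap x y refl) (prep y q)

remove : Decreasing ls → x ∈ ls → ∃ λ r → x ∷ r ↭ ls × Decreasing r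
remove (_ ∷ d) (here refl) = _ , refl , d
remove {y ∷ ls} {x} (y> ∷ d) (there p) with r , q , d′ ← remove d p =
  y ∷ r , trans (swap x y refl) (prep y q) ,
  All.tail (All-resp-↭ (↭-sym q) y>) ∷ d′

-- The invariant, for greatest letter m and second greatest letter s: mobile words
-- with this property are of the first kind, the others of the second kind.
data SecondLeads (m s : ℕ) : Word → Set where
  first : SecondLeads m s (s ∷ w)
  third : SecondLeads m s (x ∷ m ∷ s ∷ w)

data Starts (m : ℕ) : Word → Set where
  starts : Starts m (m ∷ w)

≢⇒¬Starts : x ≢ m → ¬ Starts m (x ∷ w)
≢⇒¬Starts x≢m starts = x≢m refl

-- Active words not starting with the greatest letter m.
record Mobile (m : ℕ) (w : Word) : Set where
  constructor mobile
  field
    active  : Active w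
    ¬starts : ¬ Starts m w

-- The position of a letter relative to the two greatest letters m and s.
data Letter (m s : ℕ) : ℕ → Set where
  max    : Letter m s m
  second : Letter m s s
  lower  : x < s → Letter m s x

letters : Decreasing (m ∷ s ∷ r) → w ↭ m ∷ s ∷ r → All (Letter m s) w
letters (_ ∷ s> ∷ _) p =
  All-resp-↭ (↭-sym p) (max ∷ second ∷ All.map lower s>)

≢max⇒<max : s < m → Letter m s x → x ≢ m → x < m
≢max⇒<max s<m max        x≢m = ⊥-elim (x≢m refl)
≢max⇒<max s<m second     x≢m = s<m
≢max⇒<max s<m (lower x<s) x≢m = <-trans x<s s<m

-- Removing the first letter of a mobile word

-- A mobile word of the first kind on at least four letters is equivalent to one
-- that starts with s and stays mobile without this s.
peel-second : s < m → All (Letter m s) w → Unique w → 4 ≤ length w →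
            SecondLeads m s w → Active w → ∃ λ v → w ≈ s ∷ v × Mobile m v
peel-second {w = _ ∷ _ ∷ []} _ _ _ (s≤s (s≤s ())) _ _
peel-second {w = _ ∷ _ ∷ _ ∷ []} _ _ _ (s≤s (s≤s (s≤s ()))) _ _
peel-second {s = s} {m = m} {w = i ∷ .m ∷ .s ∷ y ∷ w} s<m (li ∷ lm ∷ ls ∷ ly ∷ _)
        ((i≢m ∷ i≢s ∷ i≢y ∷ _) ∷ (m≢s ∷ m≢y ∷ _) ∷ _) _ third _ with li
... | max       = ⊥-elim (i≢m refl)
... | second    = ⊥-elim (i≢s refl)
... | lower i<s = i ∷ m ∷ y ∷ w , ≈-sym (bac≈acb i<s s<m) ,
  mobile (here (peak (<-trans i<s s<m) (≢max⇒<max s<m ly (m≢y ∘ sym)) i≢y))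
         (≢⇒¬Starts i≢m)
peel-second {s = s} {m = m} {w = .s ∷ y ∷ z ∷ u ∷ w} s<m (_ ∷ ly ∷ lz ∷ lu ∷ _)
        ((s≢y ∷ s≢z ∷ s≢u ∷ _) ∷ (y≢z ∷ y≢u ∷ _) ∷ (z≢u ∷ _) ∷ _) _ first act
  with ly | lz | act
... | second    | _         | _ = ⊥-elim (s≢y refl)
... | _         | second    | _ = ⊥-elim (s≢z refl)
... | max       | max       | _ = ⊥-elim (y≢z refl)
... | max       | lower z<s′ | _ =
  z ∷ m ∷ u ∷ w , ≈-sym (bac≈bca z<s′ s<m) ,
  mobile (here (peak (<-trans z<s′ s<m) (≢max⇒<max s<m lu (y≢u ∘ sym)) z≢u))
         (≢⇒¬Starts (y≢z ∘ sym))
... | lower y<s | max       | _ =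
  y ∷ m ∷ u ∷ w , ε ,
  mobile (here (peak (<-trans y<s s<m) (≢max⇒<max s<m lu (z≢u ∘ sym)) y≢u))
         (≢⇒¬Starts y≢z)
... | lower y<s | lower z<s′ | there act′ =
  y ∷ z ∷ u ∷ w , ε , mobile act′ (≢⇒¬Starts (<⇒≢ (<-trans y<s s<m)))
... | lower y<s | lower z<s′ | here (bac _ s<z) = ⊥-elim (<-asym z<s′ s<z)
... | lower y<s | lower z<s′ | here (acb s<z _) = ⊥-elim (<-asym z<s′ s<z)
... | lower y<s | lower z<s′ | here (bca _ s<y) = ⊥-elim (<-asym y<s s<y)

letter⇒≤max : s < m → Letter m s x → x ≤ m
letter⇒≤max s<m max         = ≤-refl
letter⇒≤max s<m second      = <⇒≤ s<m
letter⇒≤max s<m (lower x<s) = <⇒≤ (<-trans x<s s<m)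

<letter⇒<max : s < m → Letter m s y → x < y → x < m
<letter⇒<max s<m ly x<y = <-≤-trans x<y (letter⇒≤max s<m ly)

≢max⇒<second : Letter m s y → y ≢ m → x < y → x < s
≢max⇒<second max         y≢m _   = ⊥-elim (y≢m refl)
≢max⇒<second second      _   x<y = x<y
≢max⇒<second (lower y<s) _   x<y = <-trans x<y y<s

-- A mobile word of the second kind on at least four letters is equivalent to one
-- that starts with a letter i < s and stays mobile without this i.
peel-lower : s < m → All (Letter m s) w → Unique w → 4 ≤ length w →
             ¬ SecondLeads m s w → Active w → ¬ Starts m w →
             ∃₂ λ i v → i < s × w ≈ i ∷ v × Mobile m v
peel-lower {w = _ ∷ _ ∷ []} _ _ _ (s≤s (s≤s ())) _ _
peel-lower {w = _ ∷ _ ∷ _ ∷ []} _ _ _ (s≤s (s≤s (s≤s ()))) _ _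
peel-lower {s = s} {m = m} {w = i ∷ x ∷ y ∷ z ∷ w} s<m (li ∷ lx ∷ ly ∷ lz ∷ _)
        ((i≢x ∷ i≢y ∷ i≢z ∷ _) ∷ (x≢y ∷ x≢z ∷ _) ∷ (y≢z ∷ _) ∷ _) _
        ¬sec act ¬st with li
... | max       = ⊥-elim (¬st starts)
... | second    = ⊥-elim (¬sec first)
... | lower i<s = byNext lx ly act
  where
  i<m : i < m
  i<m = <-trans i<s s<m

  -- The tail is active already, and the first letter stays.
  stay : x ≢ m → Active (x ∷ y ∷ z ∷ w) →
         ∃₂ λ i′ v → i′ < s × i ∷ x ∷ y ∷ z ∷ w ≈ i′ ∷ v × Mobile m v
  stay x≢m act′ = i , x ∷ y ∷ z ∷ w , i<s , ε , mobile act′ (≢⇒¬Starts x≢m)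

  -- The second letter is not m.  If the tail is not active, then the first three
  -- letters are red, and the inactivity of the tail determines how the fourth
  -- letter compares with them.
  notMax : x ≢ m → Active (i ∷ x ∷ y ∷ z ∷ w) →
           ∃₂ λ i′ v → i′ < s × i ∷ x ∷ y ∷ z ∷ w ≈ i′ ∷ v × Mobile m v
  notMax x≢m (there act′) = stay x≢m act′
  notMax x≢m (here (bac x<i i<y)) with <-cmp y z
  ... | tri< y<z _ _ = x , y ∷ i ∷ z ∷ w , <-trans x<i i<s , bac≈acb x<i i<y ,
    mobile (here (bac i<y y<z)) (≢⇒¬Starts (<⇒≢ (<letter⇒<max s<m lz y<z)))
  ... | tri≈ _ y≡z _ = ⊥-elim (y≢z y≡z)
  ... | tri> _ _ z<y = stay x≢m (here (peak (<-trans x<i i<y) z<y x≢z))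
  notMax x≢m (here (acb i<y y<x)) with <-cmp x z
  ... | tri< x<z _ _ = stay x≢m (here (bac y<x x<z))
  ... | tri≈ _ x≡z _ = ⊥-elim (x≢z x≡z)
  ... | tri> _ _ z<x = y , i ∷ x ∷ z ∷ w , ≢max⇒<second lx x≢m y<x ,
    ≈-sym (bac≈acb i<y y<x) ,
    mobile (here (peak (<-trans i<y y<x) z<x i≢z)) (≢⇒¬Starts (<⇒≢ i<m))
  notMax x≢m (here (bca y<i i<x)) with <-cmp x z
  ... | tri< x<z _ _ = stay x≢m (here (bac (<-trans y<i i<x) x<z))
  ... | tri≈ _ x≡z _ = ⊥-elim (x≢z x≡z)
  ... | tri> _ _ z<x = i , y ∷ x ∷ z ∷ w , i<s , ≈-sym (bac≈bca y<i i<x) ,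
    mobile (here (peak (<-trans y<i i<x) z<x y≢z))
           (≢⇒¬Starts (<⇒≢ (<-trans y<i i<m)))

  -- If the second letter is m, then the third one is below s, and moving m to
  -- the third position makes it a peak of the tail.
  byNext : Letter m s x → Letter m s y → Active (i ∷ x ∷ y ∷ z ∷ w) →
           ∃₂ λ i′ v → i′ < s × i ∷ x ∷ y ∷ z ∷ w ≈ i′ ∷ v × Mobile m v
  byNext second      _ = notMax (<⇒≢ s<m)
  byNext (lower x<s) _ = notMax (<⇒≢ (<-trans x<s s<m))
  byNext max max        _ = ⊥-elim (x≢y refl)
  byNext max second     _ = ⊥-elim (¬sec third)
  byNext max (lower y<s) _ with <-cmp i y
  ... | tri< i<y _ _ = y , i ∷ m ∷ z ∷ w , y<s ,
    ≈-sym (bac≈acb i<y (<-trans y<s s<m)) ,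
    mobile (here (peak i<m (≢max⇒<max s<m lz (x≢z ∘ sym)) i≢z))
           (≢⇒¬Starts i≢x)
  ... | tri≈ _ i≡y _ = ⊥-elim (i≢y i≡y)
  ... | tri> _ _ y<i = i , y ∷ m ∷ z ∷ w , i<s ,
    ≈-sym (bac≈bca y<i i<m) ,
    mobile (here (peak (<-trans y<s s<m) (≢max⇒<max s<m lz (x≢z ∘ sym)) y≢z))
           (≢⇒¬Starts (x≢y ∘ sym))

-- Invariance of the kind of a mobile word

second<⇒max : Letter m s x → s < x → x ≡ m
second<⇒max max         _   = refl
second<⇒max second      s<x = ⊥-elim (<-irrefl refl s<x)
second<⇒max (lower x<s) s<x = ⊥-elim (<-asym x<s s<x)

-- Each pattern has a letter above its first one, so the greatest letter of the
-- alphabet never starts a red factor.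
red-first≢max : s < m → Letter m s y → Letter m s z → Red x y z → x ≢ m
red-first≢max s<m ly lz (bac _ x<z)    = <⇒≢ (<letter⇒<max s<m lz x<z)
red-first≢max s<m ly lz (acb x<z z<y)  = <⇒≢ (<letter⇒<max s<m lz x<z)
red-first≢max s<m ly lz (bca _ x<y)    = <⇒≢ (<letter⇒<max s<m ly x<y)

-- For a word with a red prefix of length three, the invariant says that the
-- prefix contains both m and s.
red-top-two⇒secondLeads : s < m → All (Letter m s) (x ∷ y ∷ z ∷ []) → Red x y z →
                     m ∈ x ∷ y ∷ z ∷ [] → s ∈ x ∷ y ∷ z ∷ [] →
                     SecondLeads m s (x ∷ y ∷ z ∷ w)
red-top-two⇒secondLeads s<m (_ ∷ ly ∷ lz ∷ []) red (here refl) _ =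
  ⊥-elim (red-first≢max s<m ly lz red refl)
red-top-two⇒secondLeads s<m _ red (there _) (here refl) = first
red-top-two⇒secondLeads s<m _ red (there (here refl)) (there (here refl)) =
  ⊥-elim (<-irrefl refl s<m)
red-top-two⇒secondLeads s<m _ red (there (here refl)) (there (there (here refl))) = third
red-top-two⇒secondLeads s<m _ red (there (there (here refl))) (there (there (here refl))) =
  ⊥-elim (<-irrefl refl s<m)
red-top-two⇒secondLeads s<m (lx ∷ _) red (there (there (here refl))) (there (here refl)) =
  ⊥-elim (impossible red)
  where
  impossible : ¬ Red _ _ _
  impossible (bac s<x x<m) = <-irrefl (second<⇒max lx s<x) x<m
  impossible (acb _ m<s)   = <-asym s<m m<s
  impossible (bca m<x x<s) = <-asym s<m (<-trans m<x x<s)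

red-secondLeads⇒top-two : All (Letter m s) (x ∷ y ∷ z ∷ []) → Red x y z →
                     SecondLeads m s (x ∷ y ∷ z ∷ w) →
                     m ∈ x ∷ y ∷ z ∷ [] × s ∈ x ∷ y ∷ z ∷ []
red-secondLeads⇒top-two _ _ third = there (here refl) , there (there (here refl))
red-secondLeads⇒top-two (_ ∷ ly ∷ lz ∷ []) red first = top red , here refl
  where
  top : Red _ _ _ → _ ∈ _
  top (bac _ s<z)   = there (there (here (sym (second<⇒max lz s<z))))
  top (acb s<z z<y) = there (there (here (sym (second<⇒max lz s<z))))
  top (bca _ s<y)   = there (here (sym (second<⇒max ly s<y)))

-- On three letters there are no mobile words of the second kind.
secondLeads₃ : s < m → t < s → w ↭ m ∷ s ∷ t ∷ [] → Active w → SecondLeads m s w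
secondLeads₃ {w = _ ∷ []} _ _ _ (there ())
secondLeads₃ {w = _ ∷ _ ∷ []} _ _ _ (there (there ()))
secondLeads₃ {w = x ∷ y ∷ z ∷ []} s<m t<s p (here red) =
  red-top-two⇒secondLeads s<m
    (All-resp-↭ (↭-sym p) (max ∷ second ∷ lower t<s ∷ [])) red
    (∈-resp-↭ (↭-sym p) (here refl)) (∈-resp-↭ (↭-sym p) (there (here refl)))
secondLeads₃ {w = x ∷ y ∷ z ∷ []} s<m t<s p (there (there (there ())))
secondLeads₃ {w = _ ∷ _ ∷ _ ∷ _ ∷ _} s<m t<s p _ with ↭-length p
... | ()

SecondLeads-resp-Step : s < m → All (Letter m s) w → Unique w → Step w w′ →
                   SecondLeads m s w → SecondLeads m s w′
SecondLeads-resp-Step s<m (lx ∷ ly ∷ lz ∷ _) _ (here red red′ p) sec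
  with m∈ , s∈ ← red-secondLeads⇒top-two (lx ∷ ly ∷ lz ∷ []) red sec =
  red-top-two⇒secondLeads s<m (All-resp-↭ p (lx ∷ ly ∷ lz ∷ [])) red′
    (∈-resp-↭ p m∈) (∈-resp-↭ p s∈)
SecondLeads-resp-Step _ _ _ (there _) first = first
-- Below, the first letters are i m s.  A red factor starting at m is impossible,
-- and one starting at s would need a second m above s.
SecondLeads-resp-Step s<m (_ ∷ lm ∷ ls ∷ ly ∷ _) _ (there (here red _ _)) third =
  ⊥-elim (red-first≢max s<m ls ly red refl)
SecondLeads-resp-Step s<m (_ ∷ _ ∷ ls ∷ ly ∷ lz ∷ _) (_ ∷ (m≢s ∷ m≢y ∷ m≢z ∷ _) ∷ _)
                 (there (there (here red _ _))) third
  with red-secondLeads⇒top-two {w = []} (ls ∷ ly ∷ lz ∷ []) red first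
... | here m≡s , _                 = ⊥-elim (m≢s m≡s)
... | there (here m≡y) , _         = ⊥-elim (m≢y m≡y)
... | there (there (here m≡z)) , _ = ⊥-elim (m≢z m≡z)
SecondLeads-resp-Step _ _ _ (there (there (there _))) third = third

-- Each kind of mobile words is one class

secondLeads? : ∀ m s w → Dec (SecondLeads m s w)
secondLeads? m s [] = no λ ()
secondLeads? m s (x ∷ w) with x ≟ s
... | yes refl = yes first
secondLeads? m s (x ∷ [])        | no x≢s = no λ { first → x≢s refl }
secondLeads? m s (x ∷ y ∷ [])    | no x≢s = no λ { first → x≢s refl }
secondLeads? m s (x ∷ y ∷ z ∷ w) | no x≢s with y ≟ m | z ≟ s
... | yes refl | yes refl = yes third
... | no y≢m   | _        = no λ { first → x≢s refl ; third → y≢m refl }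
... | _        | no z≢s   = no λ { first → x≢s refl ; third → z≢s refl }

-- For r listing the lower letters in decreasing order, the representatives of
-- the mobile words with, respectively without, the invariant.  The second one is
-- mobile only if r is not empty.
highWord : ℕ → ℕ → Word → Word
highWord m s r = s ∷ r ++ [ m ]

lowWord : ℕ → ℕ → ℕ → Word → Word
lowWord m s t r = t ∷ s ∷ r ++ [ m ]

highWord-↭ : ∀ m s r → highWord m s r ↭ m ∷ s ∷ r
highWord-↭ m s r = ↭-sym (∷↭∷ʳ m (s ∷ r))

lowWord-↭ : ∀ m s t r → lowWord m s t r ↭ m ∷ s ∷ t ∷ r
lowWord-↭ m s t r = trans (swap t s refl) (highWord-↭ m s (t ∷ r))

-- The last three letters are in relative order 213.
highWord-active : Decreasing (m ∷ s ∷ t ∷ r) → Active (highWord m s (t ∷ r))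
highWord-active {r = []} ((s<m ∷ _) ∷ (t<s ∷ _) ∷ _) = here (bac t<s s<m)
highWord-active {r = _ ∷ _} ((_ ∷ m>) ∷ _ ∷ d) = there (highWord-active (m> ∷ d))

-- Over the alphabet m > s > t > r, all mobile words of a kind are equivalent.
record Connected (m s t : ℕ) (r : Word) : Set where
  field
    toHigh : w ↭ m ∷ s ∷ t ∷ r → Mobile m w → SecondLeads m s w →
             w ≈ highWord m s (t ∷ r)
    toLow  : w ↭ m ∷ s ∷ t ∷ r → Mobile m w → ¬ SecondLeads m s w →
             w ≈ lowWord m s t r
open Connected

connected₃ : t < s → s < m → Connected m s t []
connected₃ t<s s<m .toLow p (mobile act _) ¬sec = ⊥-elim (¬sec (secondLeads₃ s<m t<s p act))
connected₃ {t} {s} {m} t<s s<m .toHigh {w} p (mobile act _) _ = go w p act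
  where
  go : ∀ w → w ↭ m ∷ s ∷ t ∷ [] → Active w → w ≈ s ∷ t ∷ m ∷ []
  go (x ∷ y ∷ z ∷ []) p (here red) = EqClosure.return
    (here red (bac t<s s<m) (trans p (∷↭∷ʳ m (s ∷ t ∷ []))))
  go (_ ∷ _ ∷ _ ∷ []) _ (there (there (there ())))
  go (_ ∷ _ ∷ _ ∷ _ ∷ _) p _ with ↭-length p
  ... | ()
  go (_ ∷ _ ∷ []) _ (there (there ()))
  go (_ ∷ []) _ (there ())

-- The inductive step for words s v of the first kind.  If v is of the second
-- kind, the chain links it to the first kind; the words x m y t and x m t y,
-- which begin the tails in the chain, are of the second and of the first kind.
high-step : Decreasing (m ∷ s ∷ t ∷ x ∷ r) → Connected m t x r →
            v ↭ m ∷ t ∷ x ∷ r → Mobile m v →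
            s ∷ v ≈ highWord m s (t ∷ x ∷ r)
high-step {m} {s} {t} {x} {r} {v} dec conn p mob with secondLeads? m t v | r
... | yes sec | _  = ∷-cong s (conn .toHigh p mob sec)
... | no ¬sec | [] = ⊥-elim (¬sec (secondLeads₃ t<m x<t p (Mobile.active mob)))
  where
  t<m = All.head (All.tail (AllPairs.head dec))
  x<t = All.head (AllPairs.head (AllPairs.tail (AllPairs.tail dec)))
high-step {m} {s} {t} {x} {_} {v}
  ((s<m ∷ t<m ∷ x<m ∷ y<m ∷ _) ∷ (t<s ∷ x<s ∷ _) ∷ (x<t ∷ y<t ∷ _) ∷ (y<x ∷ _) ∷ _)
  conn p mob | no ¬sec | y ∷ r = begin
  s ∷ v                     ≈⟨ ∷-cong s (≈-trans (conn .toLow p mob ¬sec)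
                                               (≈-sym (conn .toLow q mob₁ ¬sec₁))) ⟩
  s ∷ x ∷ m ∷ y ∷ t ∷ r     ≈⟨ bac≈bca x<s s<m ⟩
  s ∷ m ∷ x ∷ y ∷ t ∷ r     ≈⟨ ∷-cong s (∷-cong m (bac≈bca y<x x<t)) ⟩
  s ∷ m ∷ x ∷ t ∷ y ∷ r     ≈⟨ bac≈bca x<s s<m ⟨
  s ∷ x ∷ m ∷ t ∷ y ∷ r     ≈⟨ ∷-cong s (conn .toHigh q₂ mob₂ third) ⟩
  highWord m s (t ∷ x ∷ y ∷ r) ∎
  where
  open ≈-Reasoning
  q : x ∷ m ∷ y ∷ t ∷ r ↭ m ∷ t ∷ x ∷ y ∷ r
  q = trans (swap x m refl) (prep m (shift t (x ∷ y ∷ []) r))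

  q₂ : x ∷ m ∷ t ∷ y ∷ r ↭ m ∷ t ∷ x ∷ y ∷ r
  q₂ = trans (prep x (prep m (swap t y refl))) q

  mob₁ : Mobile m (x ∷ m ∷ y ∷ t ∷ r)
  mob₁ = mobile (here (bca y<x x<m)) (≢⇒¬Starts (<⇒≢ x<m))

  ¬sec₁ : ¬ SecondLeads m t (x ∷ m ∷ y ∷ t ∷ r)
  ¬sec₁ first = <-irrefl refl x<t
  ¬sec₁ third = <-irrefl refl y<t

  mob₂ : Mobile m (x ∷ m ∷ t ∷ y ∷ r)
  mob₂ = mobile (here (acb x<t t<m)) (≢⇒¬Starts (<⇒≢ x<m))

-- The inductive step: the claim for an alphabet of at least four letters from
-- the claim for all alphabets with one letter less.
module Extend {m s t x : ℕ} {r : Word} (dec : Decreasing (m ∷ s ∷ t ∷ x ∷ r))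
         (shorter : ∀ {m s t r₁} → length r₁ ≡ length r →
               Decreasing (m ∷ s ∷ t ∷ r₁) → Connected m s t r₁) where

  alphabet : Word
  alphabet = m ∷ s ∷ t ∷ x ∷ r

  s<m : s < m
  s<m = All.head (AllPairs.head dec)

  m> : All (m >_) (t ∷ x ∷ r)
  m> = All.tail (AllPairs.head dec)

  s> : All (s >_) (t ∷ x ∷ r)
  s> = AllPairs.head (AllPairs.tail dec)

  rest : Decreasing (t ∷ x ∷ r)
  rest = AllPairs.tail (AllPairs.tail dec)

  t<s : t < s
  t<s = All.head s>

  s<⇒m< : y < s → y < m
  s<⇒m< y<s = <-trans y<s s<m

  size : w ↭ alphabet → 4 ≤ length w
  size p = subst (4 ≤_) (sym (↭-length p)) (s≤s (s≤s (s≤s (s≤s z≤n))))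

  unique : w ↭ alphabet → Unique w
  unique p = Unique-resp-↭ (↭-sym p) (decreasing⇒unique dec)

  toHigh⁺ : w ↭ alphabet → Mobile m w → SecondLeads m s w → w ≈ highWord m s (t ∷ x ∷ r)
  toHigh⁺ p (mobile act _) sec
    with v , w≈sv , mob ← peel-second s<m (letters dec p) (unique p) (size p) sec act
    = ≈-trans w≈sv (high-step dec (shorter refl (m> ∷ rest))
        (drop-∷ (trans (↭-sym (≈⇒↭ w≈sv)) (trans p (swap m s refl)))) mob)

  -- The alphabet without a letter i < s, again listed in decreasing order.
  record Remainder (i : ℕ) : Set where
    constructor remainder
    field
      {t₁}    : ℕ
      {r₁}    : Word
      len     : length r₁ ≡ length r
      dec₁    : Decreasing (m ∷ s ∷ t₁ ∷ r₁)
      rebuild : i ∷ m ∷ s ∷ t₁ ∷ r₁ ↭ alphabet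

  low∈ : i < s → i ∈ alphabet → i ∈ t ∷ x ∷ r
  low∈ i<s (here refl)         = ⊥-elim (<-asym s<m i<s)
  low∈ i<s (there (here refl)) = ⊥-elim (<-irrefl refl i<s)
  low∈ i<s (there (there i∈))  = i∈

  without : i < s → i ∈ alphabet → Remainder i
  without {i} i<s i∈ with remove rest (low∈ i<s i∈)
  ... | [] , p , _ with ↭-length p
  ...   | ()
  without {i} i<s i∈ | t₁ ∷ r₁ , p , d₁ = remainder
    (suc-injective (suc-injective (↭-length p)))
    ((s<m ∷ All.tail (All-resp-↭ (↭-sym p) m>)) ∷ All.tail (All-resp-↭ (↭-sym p) s>) ∷ d₁)
    (trans (↭-sym (shift i (m ∷ s ∷ []) (t₁ ∷ r₁))) (prep m (prep s p)))

  head∈ : i ∷ v ↭ alphabet → i ∈ alphabet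
  head∈ p = ∈-resp-↭ p (here refl)

  -- By induction, words with the same first letter i < s and mobile tails of the
  -- same kind are equivalent.
  same-second : i < s → i ∷ v ↭ alphabet → i ∷ w ↭ alphabet →
                Mobile m v → Mobile m w → SecondLeads m s v → SecondLeads m s w →
                i ∷ v ≈ i ∷ w
  same-second i<s p q mob mob′ sec sec′ with without i<s (head∈ p)
  ... | remainder len d rb = ∷-cong _ (≈-trans
    (shorter len d .toHigh (drop-∷ (trans p (↭-sym rb))) mob sec)
    (≈-sym (shorter len d .toHigh (drop-∷ (trans q (↭-sym rb))) mob′ sec′)))

  same-other : i < s → i ∷ v ↭ alphabet → i ∷ w ↭ alphabet →
               Mobile m v → Mobile m w → ¬ SecondLeads m s v → ¬ SecondLeads m s w →
               i ∷ v ≈ i ∷ w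
  same-other i<s p q mob mob′ ¬sec ¬sec′ with without i<s (head∈ p)
  ... | remainder len d rb = ∷-cong _ (≈-trans
    (shorter len d .toLow (drop-∷ (trans p (↭-sym rb))) mob ¬sec)
    (≈-sym (shorter len d .toLow (drop-∷ (trans q (↭-sym rb))) mob′ ¬sec′)))

  target : Word
  target = lowWord m s t (x ∷ r)

  second-tail-t : t ∷ v ↭ alphabet → Mobile m v → SecondLeads m s v → t ∷ v ≈ target
  second-tail-t p mob sec = same-second t<s p (lowWord-↭ m s t (x ∷ r)) mob
    (mobile (highWord-active ((s<m ∷ All.tail m>) ∷ All.tail s> ∷ AllPairs.tail rest))
            (≢⇒¬Starts (<⇒≢ s<m)))
    sec first

  -- Tails of the first kind: i is exchanged with t, which reduces to first letter t.
  second-tail : i < s → i ∷ v ↭ alphabet → Mobile m v → SecondLeads m s v →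
                i ∷ v ≈ target
  second-tail {i} {v} i<s p mob sec with low∈ i<s (head∈ p)
  ... | here refl = second-tail-t p mob sec
  ... | there i∈ with r₁ , q ← extract i∈ = begin
    i ∷ v               ≈⟨ same-second i<s p q₁ mob mob₁ sec first ⟩
    i ∷ s ∷ t ∷ m ∷ r₁  ≈⟨ acb≈bca i<t t<s ⟩
    t ∷ s ∷ i ∷ m ∷ r₁  ≈⟨ second-tail-t (trans (↭-sym (≈⇒↭ (acb≈bca i<t t<s))) q₁) mob₂ first ⟩
    target ∎
    where
    open ≈-Reasoning
    i<t : i < t
    i<t = All.lookup (AllPairs.head rest) i∈

    q₁ : i ∷ s ∷ t ∷ m ∷ r₁ ↭ alphabet
    q₁ = trans (shift m (i ∷ s ∷ t ∷ []) r₁)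
      (prep m (trans (↭-sym (shift i (s ∷ t ∷ []) r₁)) (prep s (prep t q))))

    mob₁ : Mobile m (s ∷ t ∷ m ∷ r₁)
    mob₁ = mobile (here (bac t<s s<m)) (≢⇒¬Starts (<⇒≢ s<m))

    mob₂ : Mobile m (s ∷ i ∷ m ∷ r₁)
    mob₂ = mobile (here (bac i<s s<m)) (≢⇒¬Starts (<⇒≢ s<m))

  -- Tails of the second kind, when a letter y < i is available: by induction the
  -- tail can be chosen as y s m z ..., and i y s becomes i s y, whose tail is of
  -- the first kind.
  other-tail-descend : y < i → i < s → z < s → ∀ r₁ → i ∷ m ∷ s ∷ y ∷ z ∷ r₁ ↭ alphabet →
                       i ∷ v ↭ alphabet → Mobile m v → ¬ SecondLeads m s v → i ∷ v ≈ target
  other-tail-descend {y} {i} {z} {v} y<i i<s z<s′ r₁ rb p mob ¬sec = begin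
    i ∷ v                    ≈⟨ same-other i<s p q mob mob₁ ¬sec ¬sec₁ ⟩
    i ∷ y ∷ s ∷ m ∷ z ∷ r₁   ≈⟨ bac≈bca y<i i<s ⟩
    i ∷ s ∷ y ∷ m ∷ z ∷ r₁   ≈⟨ second-tail i<s (trans (↭-sym (≈⇒↭ (bac≈bca y<i i<s))) q) mob₂ first ⟩
    target                   ∎
    where
    open ≈-Reasoning
    y<s : y < s
    y<s = <-trans y<i i<s

    q : i ∷ y ∷ s ∷ m ∷ z ∷ r₁ ↭ alphabet
    q = trans (prep i (trans (shift m (y ∷ s ∷ []) (z ∷ r₁)) (prep m (swap y s refl)))) rb

    mob₁ : Mobile m (y ∷ s ∷ m ∷ z ∷ r₁)
    mob₁ = mobile (there (here (bca z<s′ s<m))) (≢⇒¬Starts (<⇒≢ (s<⇒m< y<s)))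

    ¬sec₁ : ¬ SecondLeads m s (y ∷ s ∷ m ∷ z ∷ r₁)
    ¬sec₁ first = <-irrefl refl y<s
    ¬sec₁ third = <-irrefl refl s<m

    mob₂ : Mobile m (s ∷ y ∷ m ∷ z ∷ r₁)
    mob₂ = mobile (here (bac y<s s<m)) (≢⇒¬Starts (<⇒≢ s<m))

  -- Tails of the second kind.  If i is smaller than both t₁ and z, it is first
  -- exchanged with z.
  other-tail : i < s → i ∷ v ↭ alphabet → Mobile m v → ¬ SecondLeads m s v → i ∷ v ≈ target
  other-tail {i} {v} i<s p mob ¬sec with without i<s (head∈ p)
  ... | remainder {t₁} {[]} _ (_ ∷ (t₁<s ∷ _) ∷ _) rb =
    ⊥-elim (¬sec (secondLeads₃ s<m t₁<s (drop-∷ (trans p (↭-sym rb))) (Mobile.active mob)))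
  ... | remainder {t₁} {z ∷ r₁} _ (_ ∷ (t₁<s ∷ z<s′ ∷ _) ∷ (z<t₁ ∷ _) ∷ _) rb
    with unique rb
  ...   | (_ ∷ _ ∷ i≢t₁ ∷ i≢z ∷ _) ∷ _ with <-cmp t₁ i | <-cmp z i
  ...     | tri< t₁<i _ _ | _ = other-tail-descend t₁<i i<s z<s′ r₁ rb p mob ¬sec
  ...     | tri≈ _ t₁≡i _ | _ = ⊥-elim (i≢t₁ (sym t₁≡i))
  ...     | tri> _ _ i<t₁ | tri< z<i _ _ =
    other-tail-descend z<i i<s t₁<s r₁
      (trans (prep i (prep m (prep s (swap z t₁ refl)))) rb) p mob ¬sec
  ...     | tri> _ _ i<t₁ | tri≈ _ z≡i _ = ⊥-elim (i≢z (sym z≡i))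
  ...     | tri> _ _ i<t₁ | tri> _ _ i<z = begin
    i ∷ v                     ≈⟨ same-other i<s p q mob mob₁ ¬sec ¬sec₁ ⟩
    i ∷ t₁ ∷ z ∷ m ∷ s ∷ r₁   ≈⟨ acb≈bca i<z z<t₁ ⟩
    z ∷ t₁ ∷ i ∷ m ∷ s ∷ r₁   ≈⟨ other-tail-descend i<z z<s′ t₁<s r₁ rb′ q′ mob₂ ¬sec₂ ⟩
    target                    ∎
    where
    open ≈-Reasoning
    q : i ∷ t₁ ∷ z ∷ m ∷ s ∷ r₁ ↭ alphabet
    q = trans (prep i (trans (shift m (t₁ ∷ z ∷ []) (s ∷ r₁))
                             (prep m (shift s (t₁ ∷ z ∷ []) r₁)))) rb

    q′ : z ∷ t₁ ∷ i ∷ m ∷ s ∷ r₁ ↭ alphabet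
    q′ = trans (↭-sym (≈⇒↭ (acb≈bca i<z z<t₁))) q

    rb′ : z ∷ m ∷ s ∷ i ∷ t₁ ∷ r₁ ↭ alphabet
    rb′ = trans (trans (shift i (z ∷ m ∷ s ∷ []) (t₁ ∷ r₁))
      (prep i (↭-sym (shift z (m ∷ s ∷ t₁ ∷ []) r₁)))) rb

    mob₁ : Mobile m (t₁ ∷ z ∷ m ∷ s ∷ r₁)
    mob₁ = mobile (here (bac z<t₁ (s<⇒m< t₁<s))) (≢⇒¬Starts (<⇒≢ (s<⇒m< t₁<s)))

    ¬sec₁ : ¬ SecondLeads m s (t₁ ∷ z ∷ m ∷ s ∷ r₁)
    ¬sec₁ first = <-irrefl refl t₁<s
    ¬sec₁ third = <-irrefl refl s<m

    mob₂ : Mobile m (t₁ ∷ i ∷ m ∷ s ∷ r₁)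
    mob₂ = mobile (here (bac i<t₁ (s<⇒m< t₁<s))) (≢⇒¬Starts (<⇒≢ (s<⇒m< t₁<s)))

    ¬sec₂ : ¬ SecondLeads m s (t₁ ∷ i ∷ m ∷ s ∷ r₁)
    ¬sec₂ first = <-irrefl refl t₁<s
    ¬sec₂ third = <-irrefl refl s<m

  toLow⁺ : w ↭ alphabet → Mobile m w → ¬ SecondLeads m s w → w ≈ target
  toLow⁺ p (mobile act ¬st) ¬sec
    with i , v , i<s , w≈iv , mob ←
      peel-lower s<m (letters dec p) (unique p) (size p) ¬sec act ¬st
    with q ← trans (↭-sym (≈⇒↭ w≈iv)) p
    with secondLeads? m s v
  ... | yes sec  = ≈-trans w≈iv (second-tail i<s q mob sec)
  ... | no ¬sec′ = ≈-trans w≈iv (other-tail i<s q mob ¬sec′)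

connected : ∀ n → length r ≡ n → Decreasing (m ∷ s ∷ t ∷ r) → Connected m s t r
connected {[]} n _ ((s<m ∷ _) ∷ (t<s ∷ _) ∷ _) = connected₃ t<s s<m
connected {_ ∷ _} (suc n) eq dec = record { toHigh = E.toHigh⁺ ; toLow = E.toLow⁺ }
  where
  module E = Extend dec (λ eq′ → connected n (≡.trans eq′ (suc-injective eq)))

-- Normal forms of permutations

down : ℕ → Word
down = applyDownFrom suc

down-decreasing : ∀ n → Decreasing (down n)
down-decreasing n = AllPairs.applyDownFrom⁺₁ suc n λ j<i _ → s<s j<i

down-letters : w ↭ down (2 + n) → All (Letter (2 + n) (1 + n)) w
down-letters = letters (down-decreasing _)

down-unique : w ↭ down n → Unique w
down-unique p = Unique-resp-↭ (↭-sym p) (decreasing⇒unique (down-decreasing _))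

down-bound : w ↭ down n → All (_≤ n) w
down-bound {n = zero}  p = All-resp-↭ (↭-sym p) []
down-bound {n = suc n} p = All-resp-↭ (↭-sym p)
  (≤-refl ∷ All.map <⇒≤ (AllPairs.head (down-decreasing (suc n))))

-- The two representatives of mobile words on 3 + k letters; low k is mobile only
-- for positive k.
high low : ℕ → Word
high k = highWord (3 + k) (2 + k) (down (1 + k))
low  k = lowWord (3 + k) (2 + k) (1 + k) (down k)

down-connected : ∀ k → Connected (3 + k) (2 + k) (1 + k) (down k)
down-connected k = connected _ refl (down-decreasing (3 + k))

red? : ∀ x y z → Dec (Red x y z)
red? x y z = map′ fromSum toSum
  ((y <? x ×-dec x <? z) ⊎-dec (x <? z ×-dec z <? y) ⊎-dec (z <? x ×-dec x <? y))
  where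
  Cases : Set
  Cases = (y < x × x < z) ⊎ (x < z × z < y) ⊎ (z < x × x < y)

  fromSum : Cases → Red x y z
  fromSum (inj₁ (p , q))        = bac p q
  fromSum (inj₂ (inj₁ (p , q))) = acb p q
  fromSum (inj₂ (inj₂ (p , q))) = bca p q

  toSum : Red x y z → Cases
  toSum (bac p q) = inj₁ (p , q)
  toSum (acb p q) = inj₂ (inj₁ (p , q))
  toSum (bca p q) = inj₂ (inj₂ (p , q))

active? : ∀ w → Dec (Active w)
active? []           = no λ ()
active? (x ∷ [])     = no λ { (there ()) }
active? (x ∷ y ∷ []) = no λ { (there (there ())) }
active? (x ∷ y ∷ z ∷ w) = map′ Sum.[ here , there ]
  (λ { (here red) → inj₁ red ; (there act) → inj₂ act })
  (red? x y z ⊎-dec active? (y ∷ z ∷ w))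

-- The cases of the normal form: a leading greatest letter, an inactive word, and
-- the two kinds of mobile words.
data Kind (m s : ℕ) : Word → Set where
  leading : Kind m s (m ∷ w)
  inactive  : ¬ Starts m w → ¬ Active w → Kind m s w
  upper   : Mobile m w → SecondLeads m s w → Kind m s w
  under   : Mobile m w → ¬ SecondLeads m s w → Kind m s w

starts? : ∀ m w → Dec (Starts m w)
starts? m [] = no λ ()
starts? m (x ∷ w) with x ≟ m
... | yes refl = yes starts
... | no x≢m   = no (≢⇒¬Starts x≢m)

kind : ∀ m s w → Kind m s w
kind m s w with starts? m w
... | yes starts = leading
... | no ¬st with active? w
...   | no ¬act = inactive ¬st ¬act
...   | yes act with secondLeads? m s w
...     | yes sec = upper (mobile act ¬st) sec
...     | no ¬sec = under (mobile act ¬st) ¬sec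

-- The normal form of a permutation of 1, ..., n.  On at most two letters nothing
-- can be replaced.
normalForm : ℕ → Word → Word
normalFormOf : ∀ k w → Kind (3 + k) (2 + k) w → Word

normalForm (suc (suc (suc k))) w = normalFormOf k w (kind (3 + k) (2 + k) w)
normalForm _                   w = w

normalFormOf k _ (leading {w = w}) = 3 + k ∷ normalForm (2 + k) w
normalFormOf k w (inactive _ _) = w
normalFormOf k w (upper _ _)  = high k
normalFormOf k w (under _ _)  = low k

normalForm-leading : ∀ k w → normalForm (3 + k) (3 + k ∷ w) ≡ 3 + k ∷ normalForm (2 + k) w
normalForm-leading k w with kind (3 + k) (2 + k) (3 + k ∷ w)
... | leading                 = refl
... | inactive ¬st _            = ⊥-elim (¬st starts)
... | upper (mobile _ ¬st) _  = ⊥-elim (¬st starts)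
... | under (mobile _ ¬st) _  = ⊥-elim (¬st starts)

normalForm-inactive : ∀ k → ¬ Starts (3 + k) w → ¬ Active w → normalForm (3 + k) w ≡ w
normalForm-inactive {w} k ¬st ¬act with kind (3 + k) (2 + k) w
... | leading                 = ⊥-elim (¬st starts)
... | inactive _ _              = refl
... | upper (mobile act _) _  = ⊥-elim (¬act act)
... | under (mobile act _) _  = ⊥-elim (¬act act)

normalForm-upper : ∀ k → Mobile (3 + k) w → SecondLeads (3 + k) (2 + k) w →
                   normalForm (3 + k) w ≡ high k
normalForm-upper {w} k (mobile act ¬st) sec with kind (3 + k) (2 + k) w
... | leading       = ⊥-elim (¬st starts)
... | inactive _ ¬act = ⊥-elim (¬act act)
... | upper _ _     = refl
... | under _ ¬sec  = ⊥-elim (¬sec sec)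

normalForm-under : ∀ k → Mobile (3 + k) w → ¬ SecondLeads (3 + k) (2 + k) w →
                   normalForm (3 + k) w ≡ low k
normalForm-under {w} k (mobile act ¬st) ¬sec with kind (3 + k) (2 + k) w
... | leading       = ⊥-elim (¬st starts)
... | inactive _ ¬act = ⊥-elim (¬act act)
... | upper _ sec   = ⊥-elim (¬sec sec)
... | under _ _     = refl

normalForm-sound : ∀ n → w ↭ down n → w ≈ normalForm n w
normalForm-sound 0 _ = ε
normalForm-sound 1 _ = ε
normalForm-sound 2 _ = ε
normalForm-sound {w} (suc (suc (suc k))) p with kind (3 + k) (2 + k) w
... | leading       = ∷-cong _ (normalForm-sound (2 + k) (drop-∷ p))
... | inactive _ _    = ε
... | upper mob sec = down-connected k .toHigh p mob sec
... | under mob ¬sec = down-connected k .toLow p mob ¬sec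

Step-sym : Step v w → Step w v
Step-sym (here red red′ p) = here red′ red (↭-sym p)
Step-sym (there st)        = there (Step-sym st)

Step⇒Active : Step v w → Active v
Step⇒Active (here red _ _) = here red
Step⇒Active (there st)     = there (Step⇒Active st)

Active⇒3≤length : Active w → 3 ≤ length w
Active⇒3≤length (here _)    = s≤s (s≤s (s≤s z≤n))
Active⇒3≤length (there act) = m≤n⇒m≤1+n (Active⇒3≤length act)

-- A leading greatest letter is not moved.
step-leading : s < m → All (Letter m s) (m ∷ w) → Step (m ∷ w) v →
               ∃ λ w′ → v ≡ m ∷ w′ × Step w w′
step-leading s<m (_ ∷ ly ∷ lz ∷ _) (here red _ _) =
  ⊥-elim (red-first≢max s<m ly lz red refl)
step-leading s<m _ (there st) = _ , refl , st

Mobile-resp-Step : s < m → All (Letter m s) w → Step w v → Mobile m w → Mobile m v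
Mobile-resp-Step s<m ls st (mobile _ ¬st) = mobile (Step⇒Active (Step-sym st))
  λ { starts → case (step-leading s<m (All-resp-↭ (Step⇒↭ st) ls) (Step-sym st)) ¬st }
  where
  case : ∀ {w u} → ∃ (λ w′ → w ≡ m ∷ w′ × Step u w′) → ¬ ¬ Starts m w
  case (_ , refl , _) ¬st = ¬st starts

-- The normal form is invariant.
normalForm-resp-Step : ∀ n → w ↭ down n → Step w v → normalForm n w ≡ normalForm n v
normalForm-resp-Step {w} 0 p st with subst (3 ≤_) (↭-length p) (Active⇒3≤length (Step⇒Active st))
... | ()
normalForm-resp-Step 1 p st with subst (3 ≤_) (↭-length p) (Active⇒3≤length (Step⇒Active st))
... | s≤s ()
normalForm-resp-Step 2 p st with subst (3 ≤_) (↭-length p) (Active⇒3≤length (Step⇒Active st))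
... | s≤s (s≤s ())
normalForm-resp-Step {w} {v} (suc (suc (suc k))) p st
  with ls ← down-letters p | p′ ← trans (↭-sym (Step⇒↭ st)) p | kind (3 + k) (2 + k) w
... | leading with step-leading (n<1+n _) ls st
...   | w′ , refl , st′ =
  ≡.trans (cong (_ ∷_) (normalForm-resp-Step (2 + k) (drop-∷ p) st′))
          (sym (normalForm-leading k w′))
normalForm-resp-Step {w} {v} (suc (suc (suc k))) p st | inactive _ ¬act =
  ⊥-elim (¬act (Step⇒Active st))
normalForm-resp-Step {w} {v} (suc (suc (suc k))) p st | upper mob sec =
  sym (normalForm-upper k (Mobile-resp-Step (n<1+n _) ls st mob)
                  (SecondLeads-resp-Step (n<1+n _) ls (down-unique p) st sec))
normalForm-resp-Step {w} {v} (suc (suc (suc k))) p st | under mob ¬sec =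
  sym (normalForm-under k (Mobile-resp-Step (n<1+n _) ls st mob)
    (¬sec ∘ SecondLeads-resp-Step (n<1+n _) (down-letters p′) (down-unique p′) (Step-sym st)))

-- The list of normal forms

-- The words on 2 + k letters that are built from 12 by adding each further letter
-- at either end: these are the inactive words that remain inactive when followed
-- by a greater letter.
valleys : ℕ → List Word
valleys zero    = (1 ∷ 2 ∷ []) ∷ []
valleys (suc k) = map (3 + k ∷_) (valleys k) ++ map (_∷ʳ (3 + k)) (valleys k)

-- The representatives of the mobile words on 3 + k letters.
mobiles : ℕ → List Word
mobiles zero    = high zero ∷ []
mobiles (suc k) = high (suc k) ∷ low (suc k) ∷ []

-- The normal forms on 2 + k letters.
reps : ℕ → List Word
reps zero    = (2 ∷ 1 ∷ []) ∷ (1 ∷ 2 ∷ []) ∷ []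
reps (suc k) =
  map (3 + k ∷_) (reps k) ++ map (_∷ʳ (3 + k)) (valleys k) ++ mobiles k

increasing⇒¬Red : x < y → y < z → ¬ Red x y z
increasing⇒¬Red x<y y<z (bac y<x _) = <-asym x<y y<x
increasing⇒¬Red x<y y<z (acb _ z<y) = <-asym y<z z<y
increasing⇒¬Red x<y y<z (bca z<x _) = <-asym z<x (<-trans x<y y<z)

max-first⇒¬Red : y < x → z < x → ¬ Red x y z
max-first⇒¬Red y<x z<x (bac _ x<z) = <-asym z<x x<z
max-first⇒¬Red y<x z<x (acb x<z _) = <-asym z<x x<z
max-first⇒¬Red y<x z<x (bca _ x<y) = <-asym y<x x<y

-- Adding a greater letter after an increasing pair creates no red factor.
∷ʳ-inactive : ∀ v → All (_< m) v → m < x → ¬ Active (v ∷ʳ m) →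
              ¬ Active (v ∷ʳ m ∷ʳ x)
∷ʳ-inactive [] _ _ _ (there (there ()))
∷ʳ-inactive (y ∷ []) (y<m ∷ _) m<x _ (here red) = increasing⇒¬Red y<m m<x red
∷ʳ-inactive (y ∷ []) _ _ _ (there (there (there ())))
∷ʳ-inactive (y ∷ z ∷ []) _ _ ¬act (here red) = ¬act (here red)
∷ʳ-inactive (y ∷ z ∷ []) (_ ∷ <m) m<x ¬act (there act) =
  ∷ʳ-inactive (z ∷ []) <m m<x (¬act ∘ there) act
∷ʳ-inactive (y ∷ z ∷ u ∷ v) _ _ ¬act (here red) = ¬act (here red)
∷ʳ-inactive (y ∷ z ∷ u ∷ v) (_ ∷ <m) m<x ¬act (there act) =
  ∷ʳ-inactive (z ∷ u ∷ v) <m m<x (¬act ∘ there) act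

below : ∀ n → v ↭ down n → All (_< suc n) v
below n p = All.map s≤s (down-bound p)

-- Nor does adding a greatest letter in front of at least two lower ones.
∷-inactive : ∀ k v → v ↭ down (2 + k) → ¬ Active (v ∷ʳ x) →
              ¬ Active (3 + k ∷ v ∷ʳ x)
∷-inactive k [] p ¬act act with ↭-length p
... | ()
∷-inactive k (y ∷ []) p ¬act act with ↭-length p
... | ()
∷-inactive k (y ∷ z ∷ v) p ¬act (there act) = ¬act act
∷-inactive k (y ∷ z ∷ v) p ¬act (here red) with below (2 + k) p
... | y<m ∷ z<m ∷ _ = max-first⇒¬Red y<m z<m red

valleys-↭ : ∀ k → v ∈ valleys k → v ↭ down (2 + k)
valleys-↭ zero (here refl) = swap 1 2 refl
valleys-↭ (suc k) v∈ with ∈-++⁻ (map (3 + k ∷_) (valleys k)) v∈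
... | inj₁ v∈ˡ with _ , v∈ , refl ← ∈-map⁻ (3 + k ∷_) v∈ˡ = prep _ (valleys-↭ k v∈)
... | inj₂ v∈ʳ with v , v∈ , refl ← ∈-map⁻ (_∷ʳ (3 + k)) v∈ʳ =
  trans (↭-sym (∷↭∷ʳ (3 + k) v)) (prep _ (valleys-↭ k v∈))

valleys-inactive : ∀ k → v ∈ valleys k → 2 + k < x → ¬ Active (v ∷ʳ x)
valleys-inactive zero (here refl) 2<x (here red) = increasing⇒¬Red (s<s z<s) 2<x red
valleys-inactive zero (here refl) _ (there (there (there ())))
valleys-inactive (suc k) v∈ m<x with ∈-++⁻ (map (3 + k ∷_) (valleys k)) v∈
... | inj₁ v∈ˡ with v , v∈ , refl ← ∈-map⁻ (3 + k ∷_) v∈ˡ =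
  ∷-inactive k v (valleys-↭ k v∈) (valleys-inactive k v∈ (<-trans (n<1+n _) m<x))
... | inj₂ v∈ʳ with v , v∈ , refl ← ∈-map⁻ (_∷ʳ (3 + k)) v∈ʳ =
  ∷ʳ-inactive v (below (2 + k) (valleys-↭ k v∈)) m<x (valleys-inactive k v∈ (n<1+n _))

∷ʳ-¬Starts : ∀ k → v ↭ down (2 + k) → ¬ Starts (3 + k) (v ∷ʳ (3 + k))
∷ʳ-¬Starts {[]} k p _ with ↭-length p
... | ()
∷ʳ-¬Starts {y ∷ v} k p starts = <-irrefl refl (All.head (below (2 + k) p))

high-mobile : ∀ k → Mobile (3 + k) (high k)
high-mobile k = mobile (highWord-active (down-decreasing (3 + k))) (≢⇒¬Starts λ ())

low-mobile : ∀ k → Mobile (4 + k) (low (suc k))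
low-mobile k with (_ ∷ m>) ∷ (_ ∷ s>) ∷ _ ∷ d ← down-decreasing (4 + k) =
  mobile (there (highWord-active ((n<1+n _ ∷ All.tail m>) ∷ s> ∷ d))) (≢⇒¬Starts λ ())

low-¬secondLeads : ∀ k → ¬ SecondLeads (4 + k) (3 + k) (low (suc k))
low-¬secondLeads k ()

-- Membership in mobiles k, as an inductive family.
data InMobiles : ℕ → Word → Set where
  isHigh : InMobiles k (high k)
  isLow  : InMobiles (suc k) (low (suc k))

mobiles⁻ : ∀ k → w ∈ mobiles k → InMobiles k w
mobiles⁻ zero    (here refl)         = isHigh
mobiles⁻ (suc k) (here refl)         = isHigh
mobiles⁻ (suc k) (there (here refl)) = isLow

mobiles⁺ : InMobiles k w → w ∈ mobiles k
mobiles⁺ {zero}  isHigh = here refl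
mobiles⁺ {suc k} isHigh = here refl
mobiles⁺ {suc k} isLow  = there (here refl)

mobiles-mobile : ∀ k → w ∈ mobiles k → Mobile (3 + k) w
mobiles-mobile k w∈ with mobiles⁻ k w∈
... | isHigh = high-mobile _
... | isLow  = low-mobile _

-- Membership in reps (suc k), as an inductive family.
data InReps (k : ℕ) : Word → Set where
  leading : w ∈ reps k → InReps k (3 + k ∷ w)
  valley  : v ∈ valleys k → InReps k (v ∷ʳ (3 + k))
  mobile  : w ∈ mobiles k → InReps k w

reps⁻ : ∀ k → w ∈ reps (suc k) → InReps k w
reps⁻ k w∈ with ∈-++⁻ (map (3 + k ∷_) (reps k)) w∈
... | inj₁ w∈ with _ , w∈ , refl ← ∈-map⁻ (3 + k ∷_) w∈ = leading w∈
... | inj₂ w∈ with ∈-++⁻ (map (_∷ʳ (3 + k)) (valleys k)) w∈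
...   | inj₂ w∈ = mobile w∈
...   | inj₁ w∈ with _ , w∈ , refl ← ∈-map⁻ (_∷ʳ (3 + k)) w∈ = valley w∈

reps⁺ : InReps k w → w ∈ reps (suc k)
reps⁺ (leading w∈) = ∈-++⁺ˡ (∈-map⁺ _ w∈)
reps⁺ {k} (valley v∈) = ∈-++⁺ʳ (map (3 + k ∷_) (reps k)) (∈-++⁺ˡ (∈-map⁺ (_∷ʳ (3 + k)) v∈))
reps⁺ {k} (mobile w∈) =
  ∈-++⁺ʳ (map (3 + k ∷_) (reps k)) (∈-++⁺ʳ (map (_∷ʳ (3 + k)) (valleys k)) w∈)

reps-↭ : ∀ k → w ∈ reps k → w ↭ down (2 + k)
reps-↭ zero (here refl)         = refl
reps-↭ zero (there (here refl)) = swap 1 2 refl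
reps-↭ (suc k) w∈ with reps⁻ k w∈
... | leading w∈ = prep _ (reps-↭ k w∈)
... | valley {v} v∈ = trans (↭-sym (∷↭∷ʳ (3 + k) v)) (prep _ (valleys-↭ k v∈))
... | mobile w∈ with mobiles⁻ k w∈
...   | isHigh = highWord-↭ _ _ _
...   | isLow  = lowWord-↭ _ _ _ _

normalForm-reps : ∀ k → w ∈ reps k → normalForm (2 + k) w ≡ w
normalForm-reps zero _ = refl
normalForm-reps (suc k) w∈ with reps⁻ k w∈
... | leading {w} w∈ = ≡.trans (normalForm-leading k w) (cong (_ ∷_) (normalForm-reps k w∈))
... | valley v∈ =
  normalForm-inactive k (∷ʳ-¬Starts k (valleys-↭ k v∈)) (valleys-inactive k v∈ (n<1+n _))
... | mobile w∈ with mobiles⁻ k w∈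
...   | isHigh = normalForm-upper k (high-mobile k) first
...   | isLow  = normalForm-under k (low-mobile _) (low-¬secondLeads _)

two-letters : w ↭ down 2 → w ≡ 2 ∷ 1 ∷ [] ⊎ w ≡ 1 ∷ 2 ∷ []
two-letters {[]} p with ↭-length p
... | ()
two-letters {x ∷ w} p with ∈-resp-↭ p (here refl)
... | here refl         = inj₁ (cong (2 ∷_) (↭-singleton-inv (drop-∷ p)))
... | there (here refl) =
  inj₂ (cong (1 ∷_) (↭-singleton-inv (drop-∷ (trans p (swap 2 1 refl)))))

-- In an inactive word the greatest letter is at one of the ends.
inactive-max : m ∈ w → All (_≤ m) w → Unique w → ¬ Active w →
             Starts m w ⊎ ∃ λ v → w ≡ v ∷ʳ m
inactive-max (here refl) _ _ _ = inj₁ starts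
inactive-max {w = x ∷ _} (there m∈) (_ ∷ ≤m) (_ ∷ uniq) ¬act
  with inactive-max m∈ ≤m uniq (¬act ∘ there)
inactive-max {w = x ∷ _} (there m∈) _ _ _ | inj₂ (v , refl) = inj₂ (x ∷ v , refl)
inactive-max {w = x ∷ _ ∷ []} _ _ _ _ | inj₁ starts = inj₂ (x ∷ [] , refl)
inactive-max {w = x ∷ m ∷ z ∷ w} _ (x≤m ∷ _ ∷ z≤m ∷ _) ((x≢m ∷ x≢z ∷ _) ∷ (m≢z ∷ _) ∷ _) ¬act
  | inj₁ starts = ⊥-elim (¬act (here (peak (≤∧≢⇒< x≤m x≢m) (≤∧≢⇒< z≤m (m≢z ∘ sym)) x≢z)))

inactive-ends : ∀ n → w ↭ down (suc n) → ¬ Active w →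
              (∃ λ v → w ≡ suc n ∷ v × v ↭ down n) ⊎
              (∃ λ v → w ≡ v ∷ʳ suc n × v ↭ down n)
inactive-ends n p ¬act
  with inactive-max (∈-resp-↭ (↭-sym p) (here refl)) (down-bound p) (down-unique p) ¬act
... | inj₁ starts     = inj₁ (_ , refl , drop-∷ p)
... | inj₂ (v , refl) = inj₂ (v , refl , drop-∷ (trans (∷↭∷ʳ (suc n) v) p))

Active-∷ʳ : ∀ x → Active w → Active (w ∷ʳ x)
Active-∷ʳ x (here red)  = here red
Active-∷ʳ x (there act) = there (Active-∷ʳ x act)

-- The greater letter x at the end excludes v = 21, and passes the hypothesis on
-- to the shorter words: it stays when the greatest letter of v is the first one,
-- and is replaced by that letter when it is the last one.
valleys-complete : ∀ k → v ↭ down (2 + k) → 2 + k < x → ¬ Active (v ∷ʳ x) →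
                   v ∈ valleys k
valleys-complete zero p 2<x ¬act with two-letters p
... | inj₁ refl = ⊥-elim (¬act (here (bac (s<s z<s) 2<x)))
... | inj₂ refl = here refl
valleys-complete {x = x} (suc k) p m<x ¬act
  with inactive-ends (2 + k) p (¬act ∘ Active-∷ʳ x)
... | inj₁ (v , refl , q) = ∈-++⁺ˡ (∈-map⁺ (3 + k ∷_)
  (valleys-complete k q (<-trans (n<1+n _) m<x) (¬act ∘ there)))
... | inj₂ (v , refl , q) = ∈-++⁺ʳ (map (3 + k ∷_) (valleys k)) (∈-map⁺ (_∷ʳ (3 + k))
  (valleys-complete k q (n<1+n _) (¬act ∘ Active-∷ʳ x)))

normalForm∈reps : ∀ k → w ↭ down (2 + k) → normalForm (2 + k) w ∈ reps k
normalForm∈reps zero p with two-letters p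
... | inj₁ refl = here refl
... | inj₂ refl = there (here refl)
normalForm∈reps {w} (suc k) p with kind (3 + k) (2 + k) w
... | leading     = reps⁺ (leading (normalForm∈reps k (drop-∷ p)))
... | upper _ _   = reps⁺ {k} (mobile (mobiles⁺ (isHigh {k})))
... | inactive ¬st ¬act with inactive-ends (2 + k) p ¬act
...   | inj₁ (_ , refl , _) = ⊥-elim (¬st starts)
...   | inj₂ (v , refl , q) = reps⁺ (valley (valleys-complete k q (n<1+n _) ¬act))
normalForm∈reps (suc zero) p | under mob ¬sec =
  ⊥-elim (¬sec (secondLeads₃ (n<1+n _) (n<1+n _) p (Mobile.active mob)))
normalForm∈reps (suc (suc k)) p | under _ _ = reps⁺ {suc k} (mobile (mobiles⁺ (isLow {k})))

valleys-unique : ∀ k → Unique (valleys k)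
valleys-unique zero    = [] ∷ []
valleys-unique (suc k) = Unique.++⁺
  (Unique.map⁺ ∷-injectiveʳ (valleys-unique k))
  (Unique.map⁺ (∷ʳ-injectiveˡ _ _) (valleys-unique k))
  disjoint
  where
  disjoint : Disjoint (map (3 + k ∷_) (valleys k)) (map (_∷ʳ (3 + k)) (valleys k))
  disjoint (v∈ˡ , v∈ʳ)
    with u , _ , refl ← ∈-map⁻ (3 + k ∷_) v∈ˡ
       | v , v∈ , eq ← ∈-map⁻ (_∷ʳ (3 + k)) v∈ʳ =
    ∷ʳ-¬Starts k (valleys-↭ k v∈) (subst (Starts (3 + k)) eq starts)

mobiles-unique : ∀ k → Unique (mobiles k)
mobiles-unique zero    = [] ∷ []
mobiles-unique (suc k) = ((λ ()) ∷ []) ∷ [] ∷ []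

reps-unique : ∀ k → Unique (reps k)
reps-unique zero    = ((λ ()) ∷ []) ∷ [] ∷ []
reps-unique (suc k) = Unique.++⁺
  (Unique.map⁺ ∷-injectiveʳ (reps-unique k))
  (Unique.++⁺ (Unique.map⁺ (∷ʳ-injectiveˡ _ _) (valleys-unique k)) (mobiles-unique k) disjoint₂)
  disjoint₁
  where
  disjoint₂ : Disjoint (map (_∷ʳ (3 + k)) (valleys k)) (mobiles k)
  disjoint₂ (w∈ˡ , w∈ʳ) with v , v∈ , refl ← ∈-map⁻ (_∷ʳ (3 + k)) w∈ˡ =
    valleys-inactive k v∈ (n<1+n _) (Mobile.active (mobiles-mobile k w∈ʳ))

  disjoint₁ : Disjoint (map (3 + k ∷_) (reps k)) (map (_∷ʳ (3 + k)) (valleys k) ++ mobiles k)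
  disjoint₁ (w∈ˡ , w∈ʳ)
    with u , _ , refl ← ∈-map⁻ (3 + k ∷_) w∈ˡ
    with ∈-++⁻ (map (_∷ʳ (3 + k)) (valleys k)) w∈ʳ
  ... | inj₂ w∈ = Mobile.¬starts (mobiles-mobile k w∈) starts
  ... | inj₁ w∈ with v , v∈ , eq ← ∈-map⁻ (_∷ʳ (3 + k)) w∈ =
    ∷ʳ-¬Starts k (valleys-↭ k v∈) (subst (Starts (3 + k)) eq starts)

length-valleys : ∀ k → length (valleys k) ≡ 2 ^ k
length-valleys zero    = refl
length-valleys (suc k) = begin
  length (map (3 + k ∷_) (valleys k) ++ map (_∷ʳ (3 + k)) (valleys k))
    ≡⟨ length-++ (map (3 + k ∷_) (valleys k)) ⟩
  length (map (3 + k ∷_) (valleys k)) + length (map (_∷ʳ (3 + k)) (valleys k))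
    ≡⟨ cong₂ _+_ (length-map _ (valleys k)) (length-map _ (valleys k)) ⟩
  length (valleys k) + length (valleys k)
    ≡⟨ cong₂ _+_ (length-valleys k) (≡.trans (length-valleys k) (sym (+-identityʳ _))) ⟩
  2 ^ suc k ∎
  where
  open ≡.≡-Reasoning

length-reps-suc : ∀ k → length (reps (suc k)) ≡ length (reps k) + (2 ^ k + length (mobiles k))
length-reps-suc k = begin
  length (map (3 + k ∷_) (reps k) ++ map (_∷ʳ (3 + k)) (valleys k) ++ mobiles k)
    ≡⟨ length-++ (map (3 + k ∷_) (reps k)) ⟩
  length (map (3 + k ∷_) (reps k)) + length (map (_∷ʳ (3 + k)) (valleys k) ++ mobiles k)
    ≡⟨ cong₂ _+_ (length-map _ (reps k)) (length-++ (map (_∷ʳ (3 + k)) (valleys k))) ⟩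
  length (reps k) + (length (map (_∷ʳ (3 + k)) (valleys k)) + length (mobiles k))
    ≡⟨ cong (λ l → length (reps k) + (l + length (mobiles k)))
         (≡.trans (length-map _ (valleys k)) (length-valleys k)) ⟩
  length (reps k) + (2 ^ k + length (mobiles k)) ∎
  where
  open ≡.≡-Reasoning

-- The induction starts at three letters: on two letters there are two classes,
-- and the formula would give one.
length-reps : ∀ k → length (reps (suc k)) ≡ 2 ^ (1 + k) + (2 + 2 * k)
length-reps zero    = refl
length-reps (suc k) = begin
  length (reps (2 + k))                             ≡⟨ length-reps-suc (suc k) ⟩
  length (reps (suc k)) + (2 ^ suc k + 2)           ≡⟨ cong (_+ (2 ^ suc k + 2)) (length-reps k) ⟩
  2 ^ (1 + k) + (2 + 2 * k) + (2 ^ suc k + 2)       ≡⟨ arith (2 ^ suc k) k ⟩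
  2 ^ (2 + k) + (2 + 2 * suc k)                     ∎
  where
  open ≡.≡-Reasoning
  arith : ∀ p k → p + (2 + 2 * k) + (p + 2) ≡ 2 * p + (2 + 2 * suc k)
  arith = solve-∀

-- Order permutations

-- The condition on u and σ in the definition of the order permutation.
SameOrder : ∀ {c} → Vec ℕ c → Vec ℕ c → Set
SameOrder σ u = ∀ i j → (Vec.lookup σ i < Vec.lookup σ j) ⇔ (Vec.lookup u i < Vec.lookup u j)

-- The contribution of the letter z to the number of letters below x.
indicator : ℕ → ℕ → ℕ
indicator x z with z <? x
... | yes _ = 1
... | no _  = 0

-- The number of letters of w that are less than x.
countBelow : ℕ → Word → ℕ
countBelow x w = sum (map (indicator x) w)

countBelow-↭ : ∀ x → v ↭ w → countBelow x v ≡ countBelow x w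
countBelow-↭ x p = sum-↭ (map⁺ (indicator x) p)

indicator-mono : ∀ z → x ≤ y → indicator x z ≤ indicator y z
indicator-mono {x} {y} z x≤y with z <? x | z <? y
... | yes _   | yes _  = ≤-refl
... | yes z<x | no z≮y = ⊥-elim (z≮y (<-≤-trans z<x x≤y))
... | no _    | _      = z≤n

indicator-< : x < y → indicator x x < indicator y x
indicator-< {x} {y} x<y with x <? x | x <? y
... | yes x<x | _      = ⊥-elim (<-irrefl refl x<x)
... | no _    | yes _  = s≤s z≤n
... | no _    | no x≮y = ⊥-elim (x≮y x<y)

indicator-cong : ∀ {z z′} → (z < x) ⇔ (z′ < y) → indicator x z ≡ indicator y z′
indicator-cong {x} {y} {z} {z′} f with z <? x | z′ <? y
... | yes _   | yes _    = refl
... | yes z<x | no z′≮y  = ⊥-elim (z′≮y (Equivalence.to f z<x))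
... | no z≮x  | yes z′<y = ⊥-elim (z≮x (Equivalence.from f z′<y))
... | no _    | no _     = refl

countBelow-mono : ∀ w → x ≤ y → countBelow x w ≤ countBelow y w
countBelow-mono []      _   = z≤n
countBelow-mono (z ∷ w) x≤y = +-mono-≤ (indicator-mono z x≤y) (countBelow-mono w x≤y)

countBelow-< : x ∈ w → x < y → countBelow x w < countBelow y w
countBelow-< {w = _ ∷ w} (here refl) x<y =
  +-mono-<-≤ (indicator-< x<y) (countBelow-mono w (<⇒≤ x<y))
countBelow-< {w = z ∷ _} (there x∈) x<y =
  +-mono-≤-< (indicator-mono z (<⇒≤ x<y)) (countBelow-< x∈ x<y)

countBelow-cong : ∀ {c} (u v : Vec ℕ c) →
  (∀ i → (Vec.lookup u i < x) ⇔ (Vec.lookup v i < y)) →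
  countBelow x (Vec.toList u) ≡ countBelow y (Vec.toList v)
countBelow-cong []      []      _ = refl
countBelow-cong (_ ∷ u) (_ ∷ v) f =
  cong₂ _+_ (indicator-cong (f zero)) (countBelow-cong u v (f ∘ suc))

lookup∈toList : ∀ {c} (u : Vec ℕ c) i → Vec.lookup u i ∈ Vec.toList u
lookup∈toList (x ∷ u) zero    = here refl
lookup∈toList (x ∷ u) (suc i) = there (lookup∈toList u i)

-- Two arrangements of the same letters in the same relative order are equal:
-- corresponding letters have the same number of letters below them, and this
-- number increases strictly along the letters.
sameOrder-↭⇒≡ : ∀ {c} {u v : Vec ℕ c} → SameOrder u v → Vec.toList u ↭ Vec.toList v → u ≡ v
sameOrder-↭⇒≡ {u = u} {v} iso p =
  ≡.trans (sym (Vec.tabulate∘lookup u))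
    (≡.trans (Vec.tabulate-cong pointwise) (Vec.tabulate∘lookup v))
  where
  same : ∀ i → countBelow (Vec.lookup u i) (Vec.toList u) ≡
                 countBelow (Vec.lookup v i) (Vec.toList u)
  same i = ≡.trans (countBelow-cong u v λ j → iso j i) (sym (countBelow-↭ (Vec.lookup v i) p))

  pointwise : ∀ i → Vec.lookup u i ≡ Vec.lookup v i
  pointwise i with <-cmp (Vec.lookup u i) (Vec.lookup v i)
  ... | tri< u<v _ _ = ⊥-elim (<-irrefl (same i) (countBelow-< (lookup∈toList u i) u<v))
  ... | tri≈ _ u≡v _ = u≡v
  ... | tri> _ _ v<u = ⊥-elim (<-irrefl (sym (same i))
    (countBelow-< (∈-resp-↭ (↭-sym p) (lookup∈toList v i)) v<u))

-- The part of K with more than one element.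
patterns : List (Vec ℕ 3)
patterns = (2 ∷ 1 ∷ 3 ∷ []) ∷ (1 ∷ 3 ∷ 2 ∷ []) ∷ (2 ∷ 3 ∷ 1 ∷ []) ∷ []

sameOrder⇒red : ∀ {σ} → σ ∈ patterns → SameOrder σ (x ∷ y ∷ z ∷ []) → Red x y z
sameOrder⇒red (here refl) iso =
  bac (Equivalence.to (iso (suc zero) zero) (s<s z<s))
      (Equivalence.to (iso zero (suc (suc zero))) (s<s (s<s z<s)))
sameOrder⇒red (there (here refl)) iso =
  acb (Equivalence.to (iso zero (suc (suc zero))) (s<s z<s))
      (Equivalence.to (iso (suc (suc zero)) (suc zero)) (s<s (s<s z<s)))
sameOrder⇒red (there (there (here refl))) iso =
  bca (Equivalence.to (iso (suc (suc zero)) zero) (s<s z<s))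
      (Equivalence.to (iso zero (suc zero)) (s<s (s<s z<s)))

both : ∀ {P Q : Set} → P → Q → P ⇔ Q
both p q = mk⇔ (λ _ → q) (λ _ → p)

neither : ∀ {P Q : Set} → ¬ P → ¬ Q → P ⇔ Q
neither ¬p ¬q = mk⇔ (⊥-elim ∘ ¬p) (⊥-elim ∘ ¬q)

sameOrder-ranks : a < b → b < c → SameOrder (1 ∷ 2 ∷ 3 ∷ []) (a ∷ b ∷ c ∷ [])
sameOrder-ranks a<b b<c = λ where
  zero             zero             → neither (<-irrefl refl) (<-irrefl refl)
  zero             (suc zero)       → both (s<s z<s) a<b
  zero             (suc (suc zero)) → both (s<s z<s) (<-trans a<b b<c)
  (suc zero)       zero             → neither (λ { (s≤s ()) }) (<-asym a<b)
  (suc zero)       (suc zero)       → neither (<-irrefl refl) (<-irrefl refl)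
  (suc zero)       (suc (suc zero)) → both (s<s (s<s z<s)) b<c
  (suc (suc zero)) zero             → neither (λ { (s≤s ()) }) (<-asym (<-trans a<b b<c))
  (suc (suc zero)) (suc zero)       → neither (λ { (s≤s (s≤s ())) }) (<-asym b<c)
  (suc (suc zero)) (suc (suc zero)) → neither (<-irrefl refl) (<-irrefl refl)

-- Rearranging 123 and abc in the same way preserves the relative order.
sameOrder-arrange : a < b → b < c → (f : Vec (Fin 3) 3) →
  SameOrder (Vec.map (Vec.lookup (1 ∷ 2 ∷ 3 ∷ [])) f) (Vec.map (Vec.lookup (a ∷ b ∷ c ∷ [])) f)
sameOrder-arrange {a} {b} {c} a<b b<c f i j
  rewrite Vec.lookup-map i (Vec.lookup (1 ∷ 2 ∷ 3 ∷ [])) f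
        | Vec.lookup-map j (Vec.lookup (1 ∷ 2 ∷ 3 ∷ [])) f
        | Vec.lookup-map i (Vec.lookup (a ∷ b ∷ c ∷ [])) f
        | Vec.lookup-map j (Vec.lookup (a ∷ b ∷ c ∷ [])) f
  = sameOrder-ranks a<b b<c (Vec.lookup f i) (Vec.lookup f j)

red⇒order : Red x y z → ∃ λ σ → σ ∈ patterns × IsOrderPermutation (x ∷ y ∷ z ∷ []) σ
red⇒order (bac p q) = _ , here refl , swap 2 1 refl ,
  sameOrder-arrange p q (suc zero ∷ zero ∷ suc (suc zero) ∷ [])
red⇒order (acb p q) = _ , there (here refl) , prep 1 (swap 3 2 refl) ,
  sameOrder-arrange p q (zero ∷ suc (suc zero) ∷ suc zero ∷ [])
red⇒order (bca p q) = _ , there (there (here refl)) ,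
  trans (prep 2 (swap 3 1 refl)) (swap 2 1 refl) ,
  sameOrder-arrange p q (suc zero ∷ suc (suc zero) ∷ zero ∷ [])

-- Steps and replacements

++-cancelˡ-↭ : ∀ u → u ++ v ↭ u ++ w → v ↭ w
++-cancelˡ-↭ []      p = p
++-cancelˡ-↭ (x ∷ u) p = ++-cancelˡ-↭ u (drop-∷ p)

++-cancelʳ-↭ : ∀ u → v ++ u ↭ w ++ u → v ↭ w
++-cancelʳ-↭ {v} {w} u p = ++-cancelˡ-↭ u (trans (++-comm u v) (trans p (++-comm w u)))

Step-++ : ∀ u → Step v w → Step (u ++ v) (u ++ w)
Step-++ []      st = st
Step-++ (x ∷ u) st = there (Step-++ u st)

-- A replacement between factors with the same order permutation is trivial.
replacement⇒step : Replacement K n v w → v ≡ w ⊎ Step v w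
replacement⇒step {n} record
  { φ∈Sₙ = p ; ψ∈Sₙ = q ; a = a ; b = b ; u = u ; v = v ; φ≡aub = refl ; ψ≡avb = refl
  ; order-u = _ , order-u ; order-v = _ , order-v ; samePart = samePart } =
  go u v order-u order-v samePart (++-cancelʳ-↭ b (++-cancelˡ-↭ a (trans p (↭-sym q))))
  where
  go : ∀ u v {σ τ} → SameOrder σ u → SameOrder τ v → SamePart K σ τ →
       Vec.toList u ↭ Vec.toList v →
       a ++ Vec.toList u ++ b ≡ a ++ Vec.toList v ++ b ⊎
       Step (a ++ Vec.toList u ++ b) (a ++ Vec.toList v ++ b)
  go u v ou ov (inj₁ refl) p = inj₁ (cong (λ u → a ++ Vec.toList u ++ b)
    (sameOrder-↭⇒≡ (λ i j → mk⇔ (Equivalence.to (ov i j) ∘ Equivalence.from (ou i j))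
                            (Equivalence.to (ou i j) ∘ Equivalence.from (ov i j))) p))
  go (_ ∷ _ ∷ _ ∷ []) (_ ∷ _ ∷ _ ∷ []) ou ov (inj₂ (here (σ∈ , τ∈))) p =
    inj₂ (Step-++ a (here (sameOrder⇒red σ∈ ou) (sameOrder⇒red τ∈ ov) p))

-- The position of the factor that a step changes.
record Occurrence (v w : Word) : Set where
  constructor occurrence
  field
    {x₁ y₁ z₁ x₂ y₂ z₂} : ℕ
    before after : Word
    v≡   : v ≡ before ++ x₁ ∷ y₁ ∷ z₁ ∷ after
    w≡   : w ≡ before ++ x₂ ∷ y₂ ∷ z₂ ∷ after
    red₁ : Red x₁ y₁ z₁
    red₂ : Red x₂ y₂ z₂

step⇒occurrence : Step v w → Occurrence v w
step⇒occurrence (here red₁ red₂ _) = occurrence [] _ refl refl red₁ red₂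
step⇒occurrence (there {x = x} st) with step⇒occurrence st
... | occurrence u r refl refl red₁ red₂ = occurrence (x ∷ u) r refl refl red₁ red₂

step⇒replacement : IsPermutation n v → Step v w → Replacement K n v w
step⇒replacement p st with step⇒occurrence st
... | occurrence a b v≡ w≡ red₁ red₂
  with σ , σ∈ , order-u ← red⇒order red₁ | τ , τ∈ , order-v ← red⇒order red₂ = record
  { φ∈Sₙ = p ; ψ∈Sₙ = trans (↭-sym (Step⇒↭ st)) p
  ; a = a ; b = b ; u = _ ∷ _ ∷ _ ∷ [] ; v = _ ∷ _ ∷ _ ∷ []
  ; φ≡aub = v≡ ; ψ≡avb = w≡ ; σ = σ ; τ = τ
  ; order-u = order-u ; order-v = order-v ; samePart = inj₂ (here (σ∈ , τ∈)) }

≈⇒K-equivalent : IsPermutation n v → v ≈ w → EqClosure (Replacement K n) v w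
≈⇒K-equivalent p ε = ε
≈⇒K-equivalent p (fwd st ◅ sts) =
  fwd (step⇒replacement p st) ◅ ≈⇒K-equivalent (trans (↭-sym (Step⇒↭ st)) p) sts
≈⇒K-equivalent p (bwd st ◅ sts) = bwd (step⇒replacement q st) ◅ ≈⇒K-equivalent q sts
  where q = trans (Step⇒↭ st) p

applyUpTo↭down : ∀ n → applyUpTo suc n ↭ down n
applyUpTo↭down n = trans (↭-sym (↭-reverse _)) (↭-reflexive (reverse-applyUpTo suc n))

IsPermutation⇒↭down : IsPermutation n w → w ↭ down n
IsPermutation⇒↭down {n} p = trans p (applyUpTo↭down n)

normalForm-resp : EqClosure (Replacement K n) v w → normalForm n v ≡ normalForm n w
normalForm-resp {n} =
  EqClosure.gfold ≡.isEquivalence (normalForm n) λ r → resp r (replacement⇒step r)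
  where
  resp : Replacement K n v w → v ≡ w ⊎ Step v w → normalForm n v ≡ normalForm n w
  resp r (inj₁ refl) = refl
  resp r (inj₂ st)   = normalForm-resp-Step n (IsPermutation⇒↭down (Replacement.φ∈Sₙ r)) st

-- The number of classes

-- In a list without repetition, an entry has only one position.
index-unique : ∀ {A : Set} {xs : List A} {x} → Unique xs → (p : x ∈ xs) →
               ∀ i → x ≡ lookup xs i → index p ≡ i
index-unique _ (here _) zero _ = refl
index-unique (≢s ∷ _) (here refl) (suc i) eq = ⊥-elim (All.lookup ≢s (∈-lookup i) eq)
index-unique (≢s ∷ _) (there p) zero refl = ⊥-elim (All.lookup ≢s p refl)
index-unique (_ ∷ u) (there p) (suc i) eq = cong suc (index-unique u p i eq)

classes : ∀ k → HasClassCount (K-equivalence K (3 + k)) (length (reps (suc k)))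
classes k = record { to = to ; cong = cong-to ; bijective = injective , surjective }
  where
  N : ℕ
  N = 3 + k

  normalForm∈ : (w : S N) → normalForm N (proj₁ w) ∈ reps (suc k)
  normalForm∈ (_ , p) = normalForm∈reps (suc k) (IsPermutation⇒↭down p)

  to : S N → Fin (length (reps (suc k)))
  to w = index (normalForm∈ w)

  lookup-to : ∀ w → normalForm N (proj₁ w) ≡ lookup (reps (suc k)) (to w)
  lookup-to w = Any.lookup-index (normalForm∈ w)

  to-unique : ∀ w i → normalForm N (proj₁ w) ≡ lookup (reps (suc k)) i → to w ≡ i
  to-unique w = index-unique (reps-unique (suc k)) (normalForm∈ w)

  cong-to : ∀ {v w : S N} → EqClosure (Replacement K N) (proj₁ v) (proj₁ w) → to v ≡ to w
  cong-to {v} {w} v~w = to-unique v (to w) (≡.trans (normalForm-resp v~w) (lookup-to w))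

  injective : ∀ {v w : S N} → to v ≡ to w → EqClosure (Replacement K N) (proj₁ v) (proj₁ w)
  injective {v , p} {w , q} eq = ≈⇒K-equivalent p
    (≈-trans (normalForm-sound N (IsPermutation⇒↭down p))
    (subst (_≈ w) (sym normalForm≡) (≈-sym (normalForm-sound N (IsPermutation⇒↭down q)))))
    where
    normalForm≡ : normalForm N v ≡ normalForm N w
    normalForm≡ = ≡.trans (lookup-to (v , p))
      (≡.trans (cong (lookup (reps (suc k))) eq) (sym (lookup-to (w , q))))

  surjective : ∀ i → ∃ λ (w : S N) → ∀ {v : S N} →
               EqClosure (Replacement K N) (proj₁ v) (proj₁ w) → to v ≡ i
  surjective i = (rep , trans (reps-↭ (suc k) rep∈) (↭-sym (applyUpTo↭down N))) ,
    λ {v} v~w → to-unique v i (≡.trans (normalForm-resp v~w) (normalForm-reps (suc k) rep∈))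
    where
    rep : Word
    rep = lookup (reps (suc k)) i
    rep∈ : rep ∈ reps (suc k)
    rep∈ = ∈-lookup {xs = reps (suc k)} i

class-count : ∀ k → length (reps (suc k)) ≡ 2 ^ (3 + k ∸ 2) + 2 * (3 + k) ∸ 4
class-count k = begin
  length (reps (suc k))             ≡⟨ length-reps k ⟩
  2 ^ (1 + k) + (2 + 2 * k)         ≡⟨ m+n∸n≡m _ 4 ⟨
  2 ^ (1 + k) + (2 + 2 * k) + 4 ∸ 4 ≡⟨ cong (_∸ 4) (arith (2 ^ (1 + k)) k) ⟩
  2 ^ (1 + k) + 2 * (3 + k) ∸ 4     ∎
  where
  open ≡.≡-Reasoning
  arith : ∀ p k → p + (2 + 2 * k) + 4 ≡ p + 2 * (3 + k)
  arith = solve-∀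

theorem2p37 : (n : ℕ) → n ≥ 3 → HasClassCount (K-equivalence K n) (2 ^ (n ∸ 2) + 2 * n ∸ 4)
theorem2p37 (suc (suc (suc k))) (s≤s (s≤s (s≤s z≤n))) =
  subst (HasClassCount (K-equivalence K (3 + k))) (class-count k) (classes k)
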